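{- For every sequent $\Gamma\Rightarrow\Delta$: if $\mathsf{Grz_{Seq}}+\mathsf{cut}\vdash\Gamma\Rightarrow\Delta$, then $\mathsf{Grz_{Seq}}\vdash\Gamma\Rightarrow\Delta$.
   Context: Formulas are built from $\bot$ and atomic propositions using $\to$ and $\Box$. A sequent is $\Gamma\Rightarrow\Delta$ with $\Gamma,\Delta$ finite multisets of formulas; $\Box\Pi$ denotes the multiset $\{\Box B:B\in\Pi\}$. The (ordinary, finite-proof) sequent calculus $\mathsf{Grz_{Seq}}$ has initial sequents $\Gamma,A\Rightarrow A,\Delta$ (any formula $A$) and $\Gamma,\bot\Rightarrow\Delta$, and rules: $(\to_L)$ from $\Gamma,B\Rightarrow\Delta$ and $\Gamma\Rightarrow A,\Delta$ infer $\Gamma,A\to B\Rightarrow\Delta$; $(\to_R)$ from $\Gamma,A\Rightarrow B,\Delta$ infer $\Gamma\Rightarrow A\to B,\Delta$; $(\mathsf{refl})$ from $\Gamma,B,\Box B\Rightarrow\Delta$ infer $\Gamma,\Box B\Rightarrow\Delta$; $(\Box_{\mathsf{Grz}})$ from $\Box\Pi,\Box(A\to\Box A)\Rightarrow A$ infer $\Gamma,\Box\Pi\Rightarrow\Box A,\Delta$. The system $\mathsf{Grz_{Seq}}+\mathsf{cut}$ adds the rule $(\mathsf{cut})$: from $\Gamma\Rightarrow A,\Delta$ and $\Gamma,A\Rightarrow\Delta$ infer $\Gamma\Rightarrow\Delta$. Provability means existence of a finite derivation tree. -}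

module Defs where

open import Data.List.Base using (List; []; _∷_; _++_; map)
open import Data.List.Relation.Binary.Permutation.Propositional using (_↭_)
open import Data.List.Relation.Unary.All using (All)
open import Data.Nat.Base using (ℕ)
open import Data.Product.Base using (_×_)
open import Data.Sum.Base using (_⊎_)

infix  20 □_
infixr 15 _⟶_
infix  4  _⇒_ _≈ₛ_
infix  3  _⊢_

data Formula : Set where
  atom : ℕ → Formula
  ⊥′   : Formula
  _⟶_  : Formula → Formula → Formula
  □_   : Formula → Formula

-- Finite multisets are represented by lists and identified up to the
-- permutation relation _↭_; the identification is made in _≈ₛ_ below.
record Sequent : Set where
  constructor _⇒_
  field
    antecedent : List Formula
    succedent  : List Formula

open Sequent public

_≈ₛ_ : Sequent → Sequent → Set
S ≈ₛ T = antecedent S ↭ antecedent T × succedent S ↭ succedent T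

-- A set of inference rules relates a list of premises to a conclusion.
Rules : Set₁
Rules = List Sequent → Sequent → Set

data GrzSeq : Rules where
  ax   : ∀ {Γ Δ A} → GrzSeq [] (A ∷ Γ ⇒ A ∷ Δ)
  ax⊥  : ∀ {Γ Δ} → GrzSeq [] (⊥′ ∷ Γ ⇒ Δ)
  ⟶L   : ∀ {Γ Δ A B} →
         GrzSeq ((B ∷ Γ ⇒ Δ) ∷ (Γ ⇒ A ∷ Δ) ∷ []) ((A ⟶ B) ∷ Γ ⇒ Δ)
  ⟶R   : ∀ {Γ Δ A B} →
         GrzSeq ((A ∷ Γ ⇒ B ∷ Δ) ∷ []) (Γ ⇒ (A ⟶ B) ∷ Δ)
  □refl : ∀ {Γ Δ B} →
          GrzSeq ((B ∷ □ B ∷ Γ ⇒ Δ) ∷ []) (□ B ∷ Γ ⇒ Δ)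
  □Grz : ∀ {Γ Δ Π A} →
         GrzSeq ((□ (A ⟶ □ A) ∷ map □_ Π ⇒ A ∷ []) ∷ [])
                (Γ ++ map □_ Π ⇒ □ A ∷ Δ)

data Cut : Rules where
  cut : ∀ {Γ Δ A} → Cut ((Γ ⇒ A ∷ Δ) ∷ (A ∷ Γ ⇒ Δ) ∷ []) (Γ ⇒ Δ)

GrzSeq+cut : Rules
GrzSeq+cut Ps S = GrzSeq Ps S ⊎ Cut Ps S

-- R ⊢ S is the type of finite derivation trees with root S.  Every node,
-- leaves included, matches the conclusion of its rule instance as a pair of
-- multisets, so exchange is built in rather than being a rule of its own.
data _⊢_ (R : Rules) (S : Sequent) : Set where
  infer : ∀ {Ps T} → R Ps T → S ≈ₛ T → All (R ⊢_) Ps → R ⊢ S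

{-# OPTIONS --safe #-}

-- Both calculi are compared with finite trees, read as reflexive and transitive
-- Kripke models.  The rules with cut are sound for them.  Conversely, cut-free
-- backward proof search from a sequent ends in a proof or in a countermodel:
-- once □Grz has been applied to □ A, the formula □ (A ⟶ □ A) stays in the
-- antecedent, and by reflexivity it makes A false wherever □ A is to be false,
-- so that no branch applies □Grz to □ A twice.
module Submission where

open import Defs
open import Data.Empty using (⊥)
open import Data.List.Base using (List; []; _∷_; _++_; map; length; concatMap)
open import Data.List.Membership.Propositional using (_∈_; find; lose)
open import Data.List.Membership.Propositional.Properties
  using (∈-∃++; ∈-++⁺ˡ; ∈-++⁺ʳ; ∈-map⁺; ∈-concatMap⁺)
open import Data.List.Properties using (++-identityʳ)
open import Data.List.Relation.Binary.Permutation.Propositional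
  using (_↭_; ↭-refl; ↭-reflexive; ↭-sym; ↭-trans; ↭-prep; ↭-swap)
open import Data.List.Relation.Binary.Permutation.Propositional.Properties
  using (shift; ++⁺ˡ; ∈-resp-↭; All-resp-↭; Any-resp-↭; ↭-length)
open import Data.List.Relation.Binary.Subset.Propositional using (_⊆_)
open import Data.List.Relation.Unary.All as All using (All; []; _∷_)
open import Data.List.Relation.Unary.All.Properties as All using ()
open import Data.List.Relation.Unary.Any as Any using (Any; here; there)
open import Data.Nat.Base using (ℕ; _<_)
open import Data.Nat.Induction using (<-wellFounded)
open import Data.Nat.Properties using (_≟_; ≤-reflexive)
open import Data.List.Membership.DecPropositional _≟_ using (_∈?_)
open import Data.Product.Base using (_×_; _,_; ∃; proj₁; proj₂)
open import Data.Sum.Base using (_⊎_; inj₁; inj₂; [_,_]; [_,_]′; map₁; map₂)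
open import Data.Unit.Base using (⊤)
open import Function.Base using (_∘_; id)
open import Induction.WellFounded using (Acc; acc)
open import Relation.Binary.PropositionalEquality using (refl; sym)
open import Relation.Nullary using (¬_; Dec; yes; no; contradiction)
open import Relation.Nullary.Decidable using (_×-dec_; _→-dec_)

private variable
  p : ℕ
  A B F : Formula
  Γ Γ′ Δ V V′ Π : List Formula

-- Forcing on finite trees.

data Tree : Set where
  node : List ℕ → List Tree → Tree

infix 4 _⊨_ _⊨*_ _⊨?_ _⊨*?_

-- Asking each child for `□ A` makes `□` range over all descendants, the tree itself included.
-- `_⊨*_` replaces `All` to keep the recursion structural.
mutual
  _⊨_ : Tree → Formula → Set
  t         ⊨ ⊥′     = ⊥
  node P ts ⊨ atom p = p ∈ P
  t         ⊨ A ⟶ B  = t ⊨ A → t ⊨ B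
  node P ts ⊨ □ A    = node P ts ⊨ A × ts ⊨* A

  _⊨*_ : List Tree → Formula → Set
  []       ⊨* A = ⊤
  (t ∷ ts) ⊨* A = t ⊨ □ A × ts ⊨* A

mutual
  -- Replaces excluded middle in the soundness of `⟶R`.
  _⊨?_ : ∀ t A → Dec (t ⊨ A)
  t         ⊨? ⊥′     = no λ ()
  node P ts ⊨? atom p = p ∈? P
  t         ⊨? A ⟶ B  = (t ⊨? A) →-dec (t ⊨? B)
  node P ts ⊨? □ A    = (node P ts ⊨? A) ×-dec (ts ⊨*? A)

  _⊨*?_ : ∀ ts A → Dec (ts ⊨* A)
  []       ⊨*? A = yes _
  (t ∷ ts) ⊨*? A = (t ⊨? □ A) ×-dec (ts ⊨*? A)

⊨□⇒⊨ : ∀ t → t ⊨ □ A → t ⊨ A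
⊨□⇒⊨ (node _ _) = proj₁

⊨*⁺ : ∀ {ts} → All (_⊨ □ A) ts → ts ⊨* A
⊨*⁺ []       = _
⊨*⁺ (a ∷ as) = a , ⊨*⁺ as

⊨*⁻ : ∀ {ts} → ts ⊨* A → All (_⊨ □ A) ts
⊨*⁻ {ts = []}    _        = []
⊨*⁻ {ts = _ ∷ _} (a , as) = a ∷ ⊨*⁻ as

mutual
  -- Transitivity: `□ A` passes to every descendant, so every implication with conclusion `□ A`
  -- holds there.
  ⊨□⇒⊨□⟶□ : ∀ t → t ⊨ □ A → t ⊨ □ (B ⟶ □ A)
  ⊨□⇒⊨□⟶□ (node P ts) (a , as) = (λ _ → a , as) , ⊨*⇒⊨*⟶□ ts as

  ⊨*⇒⊨*⟶□ : ∀ ts → ts ⊨* A → ts ⊨* (B ⟶ □ A)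
  ⊨*⇒⊨*⟶□ []       _        = _
  ⊨*⇒⊨*⟶□ (t ∷ ts) (a , as) = ⊨□⇒⊨□⟶□ t a , ⊨*⇒⊨*⟶□ ts as

-- Soundness of the rules with cut.

module _
  (step : ∀ t → All (t ⊨_) (map □_ Π) → t ⊨ □ (A ⟶ □ A) → t ⊨ A)
  where

  mutual
    -- Induction from the leaves, the semantic form of `□Grz`. Once `□ A` holds at all children,
    -- `A ⟶ □ A` holds at the root, where `A` alone would give `□ A`, and at every descendant, so
    -- `step` yields `A` at the root.
    ⊨□-induction : ∀ t → All (λ B → t ⊨ □ B) Π → t ⊨ □ A
    ⊨□-induction (node P ts) bs = step (node P ts) (All.map⁺ bs) □A⟶□A , as
      where
      as    = ⊨*-induction ts (All.map proj₂ bs)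
      □A⟶□A = (λ a → a , as) , ⊨*⇒⊨*⟶□ ts as

    ⊨*-induction : ∀ ts → All (ts ⊨*_) Π → ts ⊨* A
    ⊨*-induction []       _  = _
    ⊨*-induction (t ∷ ts) bs =
      ⊨□-induction t (All.map proj₁ bs) , ⊨*-induction ts (All.map proj₂ bs)

_⊨ₛ_ : Tree → Sequent → Set
t ⊨ₛ (Γ ⇒ Δ) = All (t ⊨_) Γ → Any (t ⊨_) Δ

soundness : ∀ {S} → GrzSeq+cut ⊢ S → ∀ t → t ⊨ₛ S
soundness (infer {T = T} r (Γ↭ , Δ↭) ds) t =
  Any-resp-↭ (↭-sym Δ↭) ∘ sound r ds t ∘ All-resp-↭ Γ↭
  where
  sound : ∀ {Ps T} → GrzSeq+cut Ps T → All (GrzSeq+cut ⊢_) Ps → ∀ t → t ⊨ₛ T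
  sound (inj₁ ax) [] t (a ∷ _) = here a
  sound (inj₁ ⟶L) (d ∷ e ∷ []) t (ab ∷ γ) with soundness e t γ
  ... | here a  = soundness d t (ab a ∷ γ)
  ... | there δ = δ
  sound (inj₁ (⟶R {A = A})) (d ∷ []) t γ with t ⊨? A
  ... | no ¬a = here λ a → contradiction a ¬a
  ... | yes a with soundness d t (a ∷ γ)
  ...   | here b  = here λ _ → b
  ...   | there δ = there δ
  sound (inj₁ □refl) (d ∷ []) t (b ∷ γ) = soundness d t (⊨□⇒⊨ t b ∷ b ∷ γ)
  sound (inj₁ (□Grz {Γ = Γ} {A = A})) (d ∷ []) t γ =
    here (⊨□-induction step t (All.map⁻ (All.++⁻ʳ Γ γ)))
    where
    step : ∀ t → _ → t ⊨ □ (A ⟶ □ A) → t ⊨ A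
    step t bs c with soundness d t (c ∷ bs)
    ... | here a = a
  sound (inj₂ cut) (d ∷ e ∷ []) t γ with soundness d t γ
  ... | here a  = soundness e t (a ∷ γ)
  ... | there δ = δ

-- Structural rules of the cut-free calculus.

exchange : ∀ {S T} → S ≈ₛ T → GrzSeq ⊢ T → GrzSeq ⊢ S
exchange (γ , δ) (infer r (γ′ , δ′) ds) =
  infer r (↭-trans γ γ′ , ↭-trans δ δ′) ds

-- Restores a `⊥′` that saturation drops on the right. For `□Grz` the new formula joins the side
-- formulas and the premise stays as it is.
weakenʳ : GrzSeq ⊢ Γ ⇒ Δ → GrzSeq ⊢ Γ ⇒ F ∷ Δ
weakenʳ {F = F} (infer r (γ , δ) ds) = exchange (γ , ↭-prep F δ) (weaken r ds)
  where
  weaken : ∀ {Ps Γ Δ} → GrzSeq Ps (Γ ⇒ Δ) → All (GrzSeq ⊢_) Ps →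
           GrzSeq ⊢ Γ ⇒ F ∷ Δ
  weaken ax    []           = infer ax (↭-refl , ↭-swap F _ ↭-refl) []
  weaken ax⊥   []           = infer ax⊥ (↭-refl , ↭-refl) []
  weaken ⟶L    (d ∷ e ∷ []) = infer ⟶L (↭-refl , ↭-refl)
    (weakenʳ d ∷ exchange (↭-refl , ↭-swap _ F ↭-refl) (weakenʳ e) ∷ [])
  weaken ⟶R    (d ∷ [])     = infer ⟶R (↭-refl , ↭-swap F _ ↭-refl)
    (exchange (↭-refl , ↭-swap _ F ↭-refl) (weakenʳ d) ∷ [])
  weaken □refl (d ∷ [])     = infer □refl (↭-refl , ↭-refl) (weakenʳ d ∷ [])
  weaken □Grz  (d ∷ [])     = infer □Grz (↭-refl , ↭-swap F _ ↭-refl) (d ∷ [])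

∈⇒↭∷ : ∀ {X : Set} {x : X} {xs} → x ∈ xs → ∃ λ ys → xs ↭ x ∷ ys
∈⇒↭∷ {x = x} x∈xs with ∈-∃++ x∈xs
... | ys , zs , refl = ys ++ zs , shift x ys zs

∈-ax : F ∈ Γ → F ∈ Δ → GrzSeq ⊢ Γ ⇒ Δ
∈-ax F∈Γ F∈Δ = infer ax (proj₂ (∈⇒↭∷ F∈Γ) , proj₂ (∈⇒↭∷ F∈Δ)) []

-- Bounding the uses of `□Grz`.

-- V bounds the formulas □ A to which □Grz can still be applied on the branch;
-- for the others □ (A ⟶ □ A) is already in the antecedent Γ.
mutual
  Boundedˡ : List Formula → List Formula → Formula → Set
  Boundedˡ V Γ (atom p) = ⊤
  Boundedˡ V Γ ⊥′       = ⊤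
  Boundedˡ V Γ (A ⟶ B)  = Boundedʳ V Γ A × Boundedˡ V Γ B
  Boundedˡ V Γ (□ A)    = Boundedˡ V Γ A

  Boundedʳ : List Formula → List Formula → Formula → Set
  Boundedʳ V Γ (atom p) = ⊤
  Boundedʳ V Γ ⊥′       = ⊤
  Boundedʳ V Γ (A ⟶ B)  = Boundedˡ V Γ A × Boundedʳ V Γ B
  Boundedʳ V Γ (□ A)    =
    (A ∈ V ⊎ □ (A ⟶ □ A) ∈ Γ) × Boundedˡ V Γ A × Boundedʳ V Γ A

module _
  (h : ∀ {A} → A ∈ V ⊎ □ (A ⟶ □ A) ∈ Γ → A ∈ V′ ⊎ □ (A ⟶ □ A) ∈ Γ′)
  where

  mutual
    Boundedˡ-map : ∀ F → Boundedˡ V Γ F → Boundedˡ V′ Γ′ F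
    Boundedˡ-map (atom p) _       = _
    Boundedˡ-map ⊥′       _       = _
    Boundedˡ-map (A ⟶ B)  (a , b) = Boundedʳ-map A a , Boundedˡ-map B b
    Boundedˡ-map (□ A)    a       = Boundedˡ-map A a

    Boundedʳ-map : ∀ F → Boundedʳ V Γ F → Boundedʳ V′ Γ′ F
    Boundedʳ-map (atom p) _           = _
    Boundedʳ-map ⊥′       _           = _
    Boundedʳ-map (A ⟶ B)  (a , b)     = Boundedˡ-map A a , Boundedʳ-map B b
    Boundedʳ-map (□ A)    (m , l , r) = h m , Boundedˡ-map A l , Boundedʳ-map A r

-- Supplies the initial `V`; repetitions do no harm, since only the length of `V` has to decrease.
boxed : Formula → List Formula
boxed (atom p) = []
boxed ⊥′       = []
boxed (A ⟶ B)  = boxed A ++ boxed B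
boxed (□ A)    = A ∷ boxed A

boxed-bounded : ∀ F → boxed F ⊆ V → Boundedˡ V Γ F × Boundedʳ V Γ F
boxed-bounded (atom p) _ = _
boxed-bounded ⊥′       _ = _
boxed-bounded (A ⟶ B)  s
  with boxed-bounded A (s ∘ ∈-++⁺ˡ) | boxed-bounded B (s ∘ ∈-++⁺ʳ (boxed A))
... | la , ra | lb , rb = (ra , lb) , (la , rb)
boxed-bounded (□ A)    s with boxed-bounded A (s ∘ there)
... | l , r = l , inj₁ (s (here refl)) , l , r

-- Countermodels and partial valuations.

Countermodel : Sequent → Set
Countermodel (Γ ⇒ Δ) = ∃ λ t → All (t ⊨_) Γ × All (λ F → ¬ t ⊨ F) Δ

-- In State V Γ and below, Γ is the antecedent at the root of the current world.
record State (V Γ : List Formula) : Set where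
  field
    atomsˡ   : List ℕ
    boxesˡ   : List Formula
    atomsʳ   : List ℕ
    boxesʳ   : List Formula
    boundedˡ : All (Boundedˡ V Γ ∘ □_) boxesˡ
    boundedʳ : All (Boundedʳ V Γ ∘ □_) boxesʳ

  literalsˡ literalsʳ : List Formula
  literalsˡ = map atom atomsˡ ++ map □_ boxesˡ
  literalsʳ = map atom atomsʳ ++ map □_ boxesʳ

open State

private variable
  s s′ s″ : State V Γ

∅ : State V Γ
∅ = record { atomsˡ = [] ; boxesˡ = [] ; atomsʳ = [] ; boxesʳ = []
           ; boundedˡ = [] ; boundedʳ = [] }

-- True s F and False s F: the literals of s, taken as a partial valuation in
-- which boxed formulas count as atoms, make F true or false.
mutual
  True : State V Γ → Formula → Set
  True s (atom p) = p ∈ atomsˡ s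
  True s ⊥′       = ⊥
  True s (A ⟶ B)  = False s A ⊎ True s B
  True s (□ A)    = A ∈ boxesˡ s

  False : State V Γ → Formula → Set
  False s (atom p) = p ∈ atomsʳ s
  False s ⊥′       = ⊤
  False s (A ⟶ B)  = True s A × False s B
  False s (□ A)    = A ∈ boxesʳ s

infix 4 _⊑_
-- Later stages of saturation at one world. `reflexive` exempts the boxes of `s`, whose bodies may
-- still await treatment; every box added since must have a true body.
record _⊑_ (s s′ : State V Γ) : Set where
  field
    atomsˡ-⊆  : atomsˡ s ⊆ atomsˡ s′
    boxesˡ-⊆  : boxesˡ s ⊆ boxesˡ s′
    atomsʳ-⊆  : atomsʳ s ⊆ atomsʳ s′
    boxesʳ-⊆  : boxesʳ s ⊆ boxesʳ s′
    reflexive : B ∈ boxesˡ s′ → B ∈ boxesˡ s ⊎ True s′ B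

open _⊑_

mutual
  True-mono : s ⊑ s′ → ∀ F → True s F → True s′ F
  True-mono e (atom p) = atomsˡ-⊆ e
  True-mono e (A ⟶ B)  = [ inj₁ ∘ False-mono e A , inj₂ ∘ True-mono e B ]
  True-mono e (□ A)    = boxesˡ-⊆ e

  False-mono : s ⊑ s′ → ∀ F → False s F → False s′ F
  False-mono e (atom p)         = atomsʳ-⊆ e
  False-mono e ⊥′       _       = _
  False-mono e (A ⟶ B)  (a , b) = True-mono e A a , False-mono e B b
  False-mono e (□ A)            = boxesʳ-⊆ e

⊑-refl : s ⊑ s
⊑-refl = record { atomsˡ-⊆ = id ; boxesˡ-⊆ = id ; atomsʳ-⊆ = id ; boxesʳ-⊆ = id
                ; reflexive = inj₁ }

⊑-trans : s ⊑ s′ → s′ ⊑ s″ → s ⊑ s″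
⊑-trans d e = record
  { atomsˡ-⊆  = atomsˡ-⊆ e ∘ atomsˡ-⊆ d
  ; boxesˡ-⊆  = boxesˡ-⊆ e ∘ boxesˡ-⊆ d
  ; atomsʳ-⊆  = atomsʳ-⊆ e ∘ atomsʳ-⊆ d
  ; boxesʳ-⊆  = boxesʳ-⊆ e ∘ boxesʳ-⊆ d
  ; reflexive = [ map₂ (True-mono e _) ∘ reflexive d , inj₂ ] ∘ reflexive e
  }

addAtomˡ addAtomʳ : ℕ → State V Γ → State V Γ
addAtomˡ p s = record s { atomsˡ = p ∷ atomsˡ s }
addAtomʳ p s = record s { atomsʳ = p ∷ atomsʳ s }

addBoxˡ : ∀ A → Boundedˡ V Γ (□ A) → State V Γ → State V Γ
addBoxˡ A b s = record s { boxesˡ = A ∷ boxesˡ s ; boundedˡ = b ∷ boundedˡ s }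

addBoxʳ : ∀ A → Boundedʳ V Γ (□ A) → State V Γ → State V Γ
addBoxʳ A b s = record s { boxesʳ = A ∷ boxesʳ s ; boundedʳ = b ∷ boundedʳ s }

addAtomˡ-⊑ : s ⊑ addAtomˡ p s
addAtomˡ-⊑ = record { atomsˡ-⊆ = there ; boxesˡ-⊆ = id ; atomsʳ-⊆ = id
                    ; boxesʳ-⊆ = id ; reflexive = inj₁ }

addAtomʳ-⊑ : s ⊑ addAtomʳ p s
addAtomʳ-⊑ = record { atomsˡ-⊆ = id ; boxesˡ-⊆ = id ; atomsʳ-⊆ = there
                    ; boxesʳ-⊆ = id ; reflexive = inj₁ }

addBoxʳ-⊑ : ∀ {b} → s ⊑ addBoxʳ A b s
addBoxʳ-⊑ = record { atomsˡ-⊆ = id ; boxesˡ-⊆ = id ; atomsʳ-⊆ = id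
                   ; boxesʳ-⊆ = there ; reflexive = inj₁ }

-- A box added on the left gives an extension only after its body has become true, hence the later
-- stage `s′`.
addBoxˡ-⊑ : ∀ {b} → addBoxˡ A b s ⊑ s′ → True s′ A → s ⊑ s′
addBoxˡ-⊑ {A = A} {s = s} {s′ = s′} e a = record
  { atomsˡ-⊆ = atomsˡ-⊆ e ; boxesˡ-⊆ = boxesˡ-⊆ e ∘ there
  ; atomsʳ-⊆ = atomsʳ-⊆ e ; boxesʳ-⊆ = boxesʳ-⊆ e
  ; reflexive = λ b∈ → [ old , inj₂ ] (reflexive e b∈) }
  where
  old : B ∈ A ∷ boxesˡ s → B ∈ boxesˡ s ⊎ True s′ B
  old (here refl) = inj₂ a
  old (there b∈)  = inj₁ b∈

-- Saturation of a world.

_with-literals_ : Sequent → State V Γ → Sequent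
(Γ ⇒ Δ) with-literals s = Γ ++ literalsˡ s ⇒ Δ ++ literalsʳ s

unshift₂ : ∀ (F : Formula) Γ Π Δ → F ∷ Γ ++ Π ++ Δ ↭ Γ ++ Π ++ F ∷ Δ
unshift₂ F Γ Π Δ =
  ↭-sym (↭-trans (++⁺ˡ Γ (shift F Π Δ)) (shift F Γ (Π ++ Δ)))

module Saturation {V Γ₀ : List Formula} {Goal : Set} where

  private
    Outcome : Sequent → Set
    Outcome S = (GrzSeq ⊢ S) ⊎ Goal

  mutual
    -- Continuation-passing search: `k` finishes a branch on which `F` has been decomposed, and the
    -- rule for `F` is put below the derivations returned. A `Goal` is passed on unchanged, so no
    -- rule has to be shown invertible.
    saturateˡ : ∀ F (s : State V Γ₀) Γ Δ → Boundedˡ V Γ₀ F →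
      (k : ∀ s′ → s ⊑ s′ → True s′ F → Outcome ((Γ ⇒ Δ) with-literals s′)) →
      Outcome ((F ∷ Γ ⇒ Δ) with-literals s)
    saturateˡ (atom p) s Γ Δ _ k =
      map₁ (exchange (↭-sym (shift (atom p) Γ (literalsˡ s)) , ↭-refl))
           (k (addAtomˡ p s) addAtomˡ-⊑ (here refl))
    saturateˡ ⊥′ s Γ Δ _ k = inj₁ (infer ax⊥ (↭-refl , ↭-refl) [])
    saturateˡ (A ⟶ B) s Γ Δ (a , b) k
      with saturateˡ B s Γ Δ b (λ s′ e → k s′ e ∘ inj₂)
         | saturateʳ A s Γ Δ a (λ s′ e → k s′ e ∘ inj₁)
    ... | inj₁ d | inj₁ d′ = inj₁ (infer ⟶L (↭-refl , ↭-refl) (d ∷ d′ ∷ []))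
    ... | inj₁ _ | inj₂ g  = inj₂ g
    ... | inj₂ g | _       = inj₂ g
    -- `□refl` keeps its principal formula: it is stored as a literal before its body is decomposed.
    saturateˡ (□ A) s Γ Δ b k = map₁ refl-rule
      (saturateˡ A (addBoxˡ A b s) Γ Δ b λ s′ e a →
         k s′ (addBoxˡ-⊑ e a) (boxesˡ-⊆ e (here refl)))
      where
      refl-rule : GrzSeq ⊢ (A ∷ Γ ⇒ Δ) with-literals addBoxˡ A b s →
                  GrzSeq ⊢ (□ A ∷ Γ ⇒ Δ) with-literals s
      refl-rule d = infer □refl (↭-refl , ↭-refl)
        (exchange (↭-prep A □A↭ , ↭-refl) d ∷ [])
        where □A↭ = unshift₂ (□ A) Γ (map atom (atomsˡ s)) (map □_ (boxesˡ s))

    saturateʳ : ∀ F (s : State V Γ₀) Γ Δ → Boundedʳ V Γ₀ F →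
      (k : ∀ s′ → s ⊑ s′ → False s′ F → Outcome ((Γ ⇒ Δ) with-literals s′)) →
      Outcome ((Γ ⇒ F ∷ Δ) with-literals s)
    saturateʳ (atom p) s Γ Δ _ k =
      map₁ (exchange (↭-refl , ↭-sym (shift (atom p) Δ (literalsʳ s))))
           (k (addAtomʳ p s) addAtomʳ-⊑ (here refl))
    saturateʳ ⊥′ s Γ Δ _ k = map₁ weakenʳ (k s ⊑-refl _)
    saturateʳ (A ⟶ B) s Γ Δ (a , b) k =
      map₁ (λ d → infer ⟶R (↭-refl , ↭-refl) (d ∷ []))
        (saturateˡ A s Γ (B ∷ Δ) a λ s′ e a →
         saturateʳ B s′ Γ Δ b λ s″ e′ b →
         k s″ (⊑-trans e e′) (True-mono e′ A a , b))
    saturateʳ (□ A) s Γ Δ b k =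
      map₁ (exchange (↭-refl , □A↭)) (k (addBoxʳ A b s) addBoxʳ-⊑ (here refl))
      where □A↭ = unshift₂ (□ A) Δ (map atom (atomsʳ s)) (map □_ (boxesʳ s))

  saturate*ˡ : ∀ Γ (s : State V Γ₀) Δ → All (Boundedˡ V Γ₀) Γ →
    (∀ s′ → s ⊑ s′ → All (True s′) Γ → Outcome (([] ⇒ Δ) with-literals s′)) →
    Outcome ((Γ ⇒ Δ) with-literals s)
  saturate*ˡ []      s Δ []       k = k s ⊑-refl []
  saturate*ˡ (F ∷ Γ) s Δ (b ∷ bs) k =
    saturateˡ F s Γ Δ b λ s′ e f →
    saturate*ˡ Γ s′ Δ bs λ s″ e′ fs →
    k s″ (⊑-trans e e′) (True-mono e′ F f ∷ fs)

  saturate*ʳ : ∀ Δ (s : State V Γ₀) → All (Boundedʳ V Γ₀) Δ →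
    (∀ s′ → s ⊑ s′ → All (False s′) Δ → Outcome (([] ⇒ []) with-literals s′)) →
    Outcome (([] ⇒ Δ) with-literals s)
  saturate*ʳ []      s []       k = k s ⊑-refl []
  saturate*ʳ (F ∷ Δ) s (b ∷ bs) k =
    saturateʳ F s [] Δ b λ s′ e f →
    saturate*ʳ Δ s′ bs λ s″ e′ fs →
    k s″ (⊑-trans e e′) (False-mono e′ F f ∷ fs)

  saturate : ∀ {Γ Δ} → All (Boundedˡ V Γ₀) Γ → All (Boundedʳ V Γ₀) Δ →
    (∀ s → (∀ {B} → B ∈ boxesˡ s → True s B) →
       All (True s) Γ → All (False s) Δ → Outcome (literalsˡ s ⇒ literalsʳ s)) →
    Outcome (Γ ⇒ Δ)
  saturate {Γ} {Δ} bˡ bʳ k =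
    map₁ (exchange ( ↭-reflexive (sym (++-identityʳ Γ))
                   , ↭-reflexive (sym (++-identityʳ Δ))))
      (saturate*ˡ Γ ∅ Δ bˡ λ s e γ →
       saturate*ʳ Δ s bʳ λ s′ e′ δ →
       -- `∅` has no boxes to exempt, so every left box of the final state has a true body.
       k s′ ([ (λ ()) , id ] ∘ reflexive (⊑-trans e e′))
         (All.map (True-mono e′ _) γ) δ)

-- Countermodels from saturated states.

-- The children of the root of a countermodel refuting the formulas Π, in so far
-- as those are not already false at the root.
Children : State V Γ → List Formula → List Tree → Set
Children s Π ts =
  All (λ t → ∀ {B} → B ∈ boxesˡ s → t ⊨ □ B) ts ×
  All (λ A → False s A ⊎ Any (λ t → ¬ t ⊨ A) ts) Π

module Truth (s : State V Γ) {ts : List Tree}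
  (disjoint : ∀ {p} → p ∈ atomsˡ s → ¬ p ∈ atomsʳ s)
  (refl-closed : ∀ {B} → B ∈ boxesˡ s → True s B)
  (children : Children s (boxesʳ s) ts)
  where

  root : Tree
  root = node (atomsˡ s) ts

  mutual
    -- The truth lemma. A left box holds at the root by `refl-closed` and above it by `children`; a
    -- right box fails because its body fails at the root or at some child.
    True⇒⊨ : ∀ F → True s F → root ⊨ F
    True⇒⊨ (atom p) p∈        = p∈
    True⇒⊨ (A ⟶ B)  (inj₁ fa) = λ a → contradiction a (False⇒⊭ A fa)
    True⇒⊨ (A ⟶ B)  (inj₂ tb) = λ _ → True⇒⊨ B tb
    True⇒⊨ (□ A)    A∈        =
      True⇒⊨ A (refl-closed A∈) , ⊨*⁺ (All.map (λ bs → bs A∈) (proj₁ children))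

    False⇒⊭ : ∀ F → False s F → ¬ root ⊨ F
    False⇒⊭ (atom p) p∈ʳ       p∈ˡ      = disjoint p∈ˡ p∈ʳ
    False⇒⊭ (A ⟶ B)  (ta , fb) a⟶b      = False⇒⊭ B fb (a⟶b (True⇒⊨ A ta))
    False⇒⊭ (□ A)    A∈        (a , as) with All.lookup (proj₂ children) A∈
    ... | inj₁ fa = False⇒⊭ A fa a
    ... | inj₂ ¬a = All.Any¬⇒¬All ¬a (All.map (⊨□⇒⊨ _) (⊨*⁻ as))

-- Proof search and completeness.

open Saturation using (saturate)

ProvableOrRefutable : List Formula → Set
ProvableOrRefutable V = ∀ {Γ Δ} → All (Boundedˡ V Γ) Γ → All (Boundedʳ V Γ) Δ →
  (GrzSeq ⊢ Γ ⇒ Δ) ⊎ Countermodel (Γ ⇒ Δ)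

module Leaf
  (ih : ∀ {V′} → length V′ < length V → ProvableOrRefutable V′)
  (s : State V Γ)
  (refl-closed : ∀ {B} → B ∈ boxesˡ s → True s B)
  (trueˡ : All (True s) Γ)
  where

  ∈-boxesˡ : □ B ∈ Γ → B ∈ boxesˡ s
  ∈-boxesˡ = All.lookup trueˡ

  ∈-literalsˡ : A ∈ boxesˡ s → □ A ∈ literalsˡ s
  ∈-literalsˡ A∈ = ∈-++⁺ʳ (map atom (atomsˡ s)) (∈-map⁺ □_ A∈)

  ∈-literalsʳ : A ∈ boxesʳ s → □ A ∈ literalsʳ s
  ∈-literalsʳ A∈ = ∈-++⁺ʳ (map atom (atomsʳ s)) (∈-map⁺ □_ A∈)

  -- Backward `□Grz` on `□ A` trades an entry `A` of `V` for `□ (A ⟶ □ A)` in the antecedent, so `V`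
  -- gets shorter. In the new formula `A` counts as a right and `□ A` as a left occurrence, so its
  -- bounds follow from those of `A`.
  child : A ∈ V → Boundedˡ V Γ A → Boundedʳ V Γ A →
    let S = □ (A ⟶ □ A) ∷ map □_ (boxesˡ s) ⇒ A ∷ [] in
    (GrzSeq ⊢ S) ⊎ Countermodel S
  child {A = A} A∈V bˡ bʳ with ∈⇒↭∷ A∈V
  ... | V′ , V↭A∷V′ = ih (≤-reflexive (sym (↭-length V↭A∷V′)))
      ((Boundedʳ-map h A bʳ , Boundedˡ-map h A bˡ)
        ∷ All.map⁺ (All.map (λ {B} → Boundedˡ-map h B) (boundedˡ s)))
      (Boundedʳ-map h A bʳ ∷ [])
    where
    Γ⁺ = □ (A ⟶ □ A) ∷ map □_ (boxesˡ s)

    h : B ∈ V ⊎ □ (B ⟶ □ B) ∈ Γ → B ∈ V′ ⊎ □ (B ⟶ □ B) ∈ Γ⁺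
    -- Boxes of `Γ` are among the left boxes of the saturated state, which the premise keeps.
    h (inj₂ □∈Γ) = inj₂ (there (∈-map⁺ □_ (∈-boxesˡ □∈Γ)))
    h (inj₁ B∈V) with ∈-resp-↭ V↭A∷V′ B∈V
    ... | here refl  = inj₂ (here refl)
    ... | there B∈V′ = inj₁ B∈V′

  children : ∀ {Π} → All (_∈ boxesʳ s) Π → All (Boundedʳ V Γ ∘ □_) Π →
    (GrzSeq ⊢ literalsˡ s ⇒ literalsʳ s) ⊎ ∃ (Children s Π)
  children []        []       = inj₂ ([] , [] , [])
  children (A∈ ∷ Π⊆) ((m , bˡ , bʳ) ∷ bs) with children Π⊆ bs
  ... | inj₁ d = inj₁ d
  ... | inj₂ (ts , cs , rs) with m
  ...   | inj₂ □∈Γ with refl-closed (∈-boxesˡ □∈Γ)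
  ...     | inj₁ fa  = inj₂ (ts , cs , inj₁ fa ∷ rs)
  ...     | inj₂ A∈ˡ = inj₁ (∈-ax (∈-literalsˡ A∈ˡ) (∈-literalsʳ A∈))
  children (A∈ ∷ Π⊆) ((m , bˡ , bʳ) ∷ bs) | inj₂ (ts , cs , rs) | inj₁ A∈V
    with child A∈V bˡ bʳ
  ... | inj₁ d =
    inj₁ (infer □Grz (↭-refl , proj₂ (∈⇒↭∷ (∈-literalsʳ A∈))) (d ∷ []))
  ... | inj₂ (t , _ ∷ bs , ¬a ∷ []) = inj₂
    ( t ∷ ts
    , (λ B∈ → All.lookup bs (∈-map⁺ □_ B∈)) ∷ cs
    , inj₂ (here ¬a) ∷ All.map (map₂ there) rs
    )

  leaf : All (False s) Δ →
    (GrzSeq ⊢ literalsˡ s ⇒ literalsʳ s) ⊎ Countermodel (Γ ⇒ Δ)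
  leaf falseʳ with Any.any? (_∈? atomsʳ s) (atomsˡ s)
  ... | yes clash with find clash
  ...   | p , p∈ˡ , p∈ʳ =
    inj₁ (∈-ax (∈-++⁺ˡ (∈-map⁺ atom p∈ˡ)) (∈-++⁺ˡ (∈-map⁺ atom p∈ʳ)))
  leaf falseʳ | no ¬clash with children (All.tabulate id) (boundedʳ s)
  ... | inj₁ d        = inj₁ d
  ... | inj₂ (ts , c) =
    inj₂ (root , All.map (True⇒⊨ _) trueˡ , All.map (False⇒⊭ _) falseʳ)
    where open Truth s (λ p∈ˡ p∈ʳ → ¬clash (lose p∈ˡ p∈ʳ)) refl-closed c

provableOrRefutable : ∀ V → Acc _<_ (length V) → ProvableOrRefutable V
provableOrRefutable V (acc rs) bˡ bʳ = saturate bˡ bʳ λ s refl-closed trueˡ →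
  Leaf.leaf (λ lt → provableOrRefutable _ (rs lt)) s refl-closed trueˡ

completeness : ∀ Γ Δ → (∀ t → t ⊨ₛ (Γ ⇒ Δ)) → GrzSeq ⊢ Γ ⇒ Δ
completeness Γ Δ valid =
  [ id , (λ (t , γ , ¬δ) → contradiction (valid t γ) (All.All¬⇒¬Any ¬δ)) ]′
    (provableOrRefutable bodies (<-wellFounded _)
      (All.map proj₁ (bounded ∈-++⁺ˡ)) (All.map proj₂ (bounded (∈-++⁺ʳ Γ))))
  where
  bodies = concatMap boxed (Γ ++ Δ)

  bounded : Π ⊆ Γ ++ Δ → All (λ F → Boundedˡ bodies Γ F × Boundedʳ bodies Γ F) Π
  bounded Π⊆ = All.tabulate λ {F} F∈ →
    boxed-bounded F λ A∈ → ∈-concatMap⁺ boxed (lose (Π⊆ F∈) A∈)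

theorem2p2 : (Γ Δ : List Formula) → GrzSeq+cut ⊢ (Γ ⇒ Δ) → GrzSeq ⊢ (Γ ⇒ Δ)
theorem2p2 Γ Δ = completeness Γ Δ ∘ soundness
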